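{- Let $\sigma \ge 2$ be an integer and let $A$ be an alphabet of size $\sigma$. Define $\xi(2) = 8$ and $\xi(\sigma) = \frac{2\sigma^3 - 2\sigma^2}{(\sigma-2)(\sigma^2-2\sigma+2)}$ for $\sigma > 2$. Then the expected length of the maximal unbordered factor of a uniformly random string of length $n$ over $A$ is at least $$n\cdot\bigl(1 - \xi(\sigma)\cdot\sigma^{ -4}\bigr) + \mathcal{O}(1);$$ that is, for each $\sigma \ge 2$ there is a constant $C$ (independent of $n$) such that for all $n \ge 1$, $$\frac{1}{\sigma^n}\sum_{S\in A^n} b(S) \;\ge\; n\cdot\bigl(1-\xi(\sigma)\cdot\sigma^{ -4}\bigr) - C .$$
   Context: $A^n$ is the set of all strings of length $n$ over the finite alphabet $A$, and expectations are taken with respect to the uniform distribution on $A^n$. A factor of a string $S=S[1]\cdots S[n]$ is a contiguous substring $S[i..j]=S[i]\cdots S[j]$, $1\le i\le j\le n$. A prefix or suffix of $S$ is proper if it is non-empty and different from $S$. A border of a string is a proper prefix of it that is simultaneously a suffix of it. A string is unbordered if it has no border (in particular every string of length 1 is unbordered). The maximal unbordered factor of $S$ is a longest factor of $S$ that is unbordered; $b(S)$ denotes its length. -}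

module Defs where

open import Data.Empty using (⊥-elim)
open import Data.Fin.Base using (Fin)
open import Data.Fin.Properties using (inj⇒≟)
open import Data.Integer.Base using (+_)
open import Data.List.Base using (List; []; _∷_; _++_; [_]; length; map; inits; filter; allFin; cartesianProductWith)
open import Data.List.Extrema.Nat using (argmax; argmax-sel; f[xs]≤f[argmax])
open import Data.List.Membership.Propositional using (_∈_; lose)
open import Data.List.Membership.Propositional.Properties using (∈-map⁺; ∈-map⁻; ∈-++⁺ˡ; ∈-++⁺ʳ; ∈-++⁻; ∈-filter⁺; ∈-filter⁻)
open import Data.List.Properties using (≡-dec)
open import Data.List.Relation.Binary.Infix.Heterogeneous using (Infix; here; there)
open import Data.List.Relation.Binary.Prefix.Heterogeneous using (Prefix; []; _∷_)
open import Data.List.Relation.Binary.Prefix.Heterogeneous.Properties using (prefix?)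
open import Data.List.Relation.Binary.Suffix.Heterogeneous using (Suffix)
open import Data.List.Relation.Binary.Suffix.Heterogeneous.Properties using (suffix?)
open import Data.List.Relation.Unary.All as All using ()
open import Data.List.Relation.Unary.Any using (here; there; any?; satisfied)
open import Data.Nat.Base using (ℕ; zero; suc; _+_; _*_; _∸_; _^_; _≤_; NonZero; NonTrivial; nonTrivial⇒nonZero)
open import Data.Nat.ListAction using (sum)
open import Data.Nat.Properties using (m*n≢0; m^n≢0; +-comm)
open import Data.Product.Base using (_×_; _,_; proj₁; proj₂)
open import Data.Rational.Base as ℚ using (ℚ)
open import Data.Sum.Base using (inj₁; inj₂)
open import Data.Vec.Base as Vec using (Vec)
open import Function.Bundles using (_↔_; Inverse)
open import Function.Properties.Inverse using (↔⇒↣)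
open import Relation.Binary.Definitions using (DecidableEquality)
open import Relation.Binary.PropositionalEquality using (_≡_; _≢_; refl; subst)
open import Relation.Nullary using (¬_; Dec; yes; no; ¬?; _×-dec_)

ProperPrefix : {A : Set} → List A → List A → Set
ProperPrefix U S = U ≢ [] × U ≢ S × Prefix _≡_ U S

Border : {A : Set} → List A → List A → Set
Border U S = ProperPrefix U S × Suffix _≡_ U S

Unbordered : {A : Set} → List A → Set
Unbordered S = ∀ U → ¬ Border U S

Factor : {A : Set} → List A → List A → Set
Factor U S = U ≢ [] × Infix _≡_ U S

-- All S[i..j] with 1 ≤ i ≤ j ≤ n, one entry for each pair (i , j).
factors : {A : Set} → List A → List (List A)
factors []       = []
factors (x ∷ xs) = map (x ∷_) (inits xs) ++ factors xs

module _ {A : Set} where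

  prefix⇒∈inits : ∀ {U S : List A} → Prefix _≡_ U S → U ∈ inits S
  prefix⇒∈inits []         = here refl
  prefix⇒∈inits (refl ∷ p) = there (∈-map⁺ (_ ∷_) (prefix⇒∈inits p))

  ∈inits⇒prefix : ∀ {U : List A} S → U ∈ inits S → Prefix _≡_ U S
  ∈inits⇒prefix S        (here refl) = []
  ∈inits⇒prefix (x ∷ xs) (there i) with ∈-map⁻ (x ∷_) {xs = inits xs} i
  ... | _ , j , refl = refl ∷ ∈inits⇒prefix xs j

  ∈factors⇒factor : ∀ {U : List A} S → U ∈ factors S → Factor U S
  ∈factors⇒factor (x ∷ xs) i with ∈-++⁻ (map (x ∷_) (inits xs)) i
  ... | inj₂ j = let U≢[] , inf = ∈factors⇒factor xs j in U≢[] , there inf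
  ... | inj₁ j with ∈-map⁻ (x ∷_) {xs = inits xs} j
  ...   | _ , k , refl = (λ ()) , here (refl ∷ ∈inits⇒prefix xs k)

  factor⇒∈factors : ∀ {U S : List A} → Factor U S → U ∈ factors S
  factor⇒∈factors (U≢[] , here [])         = ⊥-elim (U≢[] refl)
  factor⇒∈factors (U≢[] , here (refl ∷ p)) = ∈-++⁺ˡ (∈-map⁺ (_ ∷_) (prefix⇒∈inits p))
  factor⇒∈factors (U≢[] , there {b} {bs = bs} inf) =
    ∈-++⁺ʳ (map (b ∷_) (inits bs)) (factor⇒∈factors (U≢[] , inf))

module _ {A : Set} (_≟_ : DecidableEquality A) where

  border? : (U S : List A) → Dec (Border U S)
  border? U S =
    (¬? (≡-dec _≟_ U []) ×-dec ¬? (≡-dec _≟_ U S) ×-dec prefix? _≟_ U S)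
    ×-dec suffix? _≟_ U S

  unbordered? : (S : List A) → Dec (Unbordered S)
  unbordered? S with any? (λ U → border? U S) (inits S)
  ... | yes bordered = no λ unb → let U , bU = satisfied bordered in unb U bU
  ... | no  ¬border  = yes λ U bU →
    ¬border (lose (prefix⇒∈inits (proj₂ (proj₂ (proj₁ bU)))) bU)

  -- The default [] of argmax is returned only for S = [].
  maximalUnborderedFactor : List A → List A
  maximalUnborderedFactor S = argmax length [] (filter unbordered? (factors S))

  b : List A → ℕ
  b S = length (maximalUnborderedFactor S)

  maximalUnborderedFactor-longest :
    ∀ {U S} → Factor U S → Unbordered U → length U ≤ b S
  maximalUnborderedFactor-longest {S = S} f u =
    All.lookup (f[xs]≤f[argmax] [] (filter unbordered? (factors S)))
               (∈-filter⁺ unbordered? (factor⇒∈factors f) u)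

  singleton-unbordered : (x : A) → Unbordered [ x ]
  singleton-unbordered x _ ((U≢[] , _ , []) , _)       = U≢[] refl
  singleton-unbordered x _ ((_ , U≢S , refl ∷ []) , _) = U≢S refl

  maximalUnborderedFactor-unbordered-factor :
    ∀ S → S ≢ [] →
    Factor (maximalUnborderedFactor S) S × Unbordered (maximalUnborderedFactor S)
  maximalUnborderedFactor-unbordered-factor [] S≢[] = ⊥-elim (S≢[] refl)
  maximalUnborderedFactor-unbordered-factor S@(x ∷ xs) _
    with argmax-sel length [] (filter unbordered? (factors S))
  ... | inj₂ i = let j , u = ∈-filter⁻ unbordered? {xs = factors S} i
                 in ∈factors⇒factor S j , u
  ... | inj₁ eq with subst (λ U → 1 ≤ length U) eq
                       (maximalUnborderedFactor-longest {S = S}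
                         ((λ ()) , here (refl ∷ [])) (singleton-unbordered x))
  ...   | ()

strings : {A : Set} → List A → (n : ℕ) → List (Vec A n)
strings letters zero    = [ Vec.[] ]
strings letters (suc n) = cartesianProductWith Vec._∷_ letters (strings letters n)

_^-_ : (σ k : ℕ) .{{_ : NonTrivial σ}} → ℚ
σ ^- k = ((+ 1) ℚ./ (σ ^ k)) {{m^n≢0 σ k {{nonTrivial⇒nonZero σ}}}}

fromℕ : ℕ → ℚ
fromℕ n = (+ n) ℚ./ 1

module _ {A : Set} {σ : ℕ} .{{_ : NonTrivial σ}} (alphabet : A ↔ Fin σ) where

  𝔼 : (n : ℕ) → (Vec A n → ℕ) → ℚ
  𝔼 n X = (σ ^- n) ℚ.* fromℕ (sum (map X (strings letters n)))
    where
    letters : List A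
    letters = map (Inverse.from alphabet) (allFin σ)

  expectedMaximalUnborderedFactorLength : ℕ → ℚ
  expectedMaximalUnborderedFactorLength n =
    𝔼 n (λ S → b (inj⇒≟ (↔⇒↣ alphabet)) (Vec.toList S))

-- For σ ≥ 3 no ∸ below truncates.
ξ : (σ : ℕ) .{{_ : NonTrivial σ}} → ℚ
ξ 2                      = (+ 8) ℚ./ 1
ξ σ@(suc (suc (suc k))) =
  ((+ (2 * σ ^ 3 ∸ 2 * σ ^ 2)) ℚ./ ((σ ∸ 2) * (σ ^ 2 ∸ 2 * σ + 2)))
    {{m*n≢0 (suc k) (σ ^ 2 ∸ 2 * σ + 2) {{_}} {{+2≢0 (σ ^ 2 ∸ 2 * σ)}}}}
  where
  +2≢0 : ∀ m → NonZero (m + 2)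
  +2≢0 m = subst NonZero (+-comm 2 m) _

{-# OPTIONS --safe #-}

-- For every q there is a K, depending only on σ and q, such that all but a fraction 1/q of the
-- strings of each length n ≥ 2K have an unbordered factor of length at least n − K; taking
-- 1/q ≤ ξ(σ)σ⁻⁴ gives the bound. To find the factor, write S = h r with |h| = K, let x be one
-- of two fixed letters in which r does not end, and let v be a suffix of h starting with xᵗ;
-- such a v exists unless h avoids xᵗ, which is unlikely for large K. If v r is bordered, then
-- v r = U W U with U non-empty. As r does not end in x, |U| > t, and U as a suffix of r is
-- determined by the letters before it, so this happens with probability at most
-- Σ_{l > t} σ⁻ˡ ≤ σ⁻ᵗ.
module Submission where

open import Defs
open import Data.Bool.Base using (if_then_else_)
open import Data.Fin.Base using (Fin; zero; suc)
open import Data.Fin.Properties using (inj⇒≟)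
import Data.Integer.Base as ℤ
import Data.Integer.Properties as ℤ
open import Data.List.Base using (List; []; _∷_; _++_; _∷ʳ_; length; map; take; drop; replicate; allFin; cartesianProductWith; initLast; _∷ʳ′_)
open import Data.List.Membership.Propositional using (_∈_)
open import Data.List.Membership.Propositional.Properties using (∈-map⁺; ∈-allFin)
open import Data.List.Properties using (≡-dec; ++-assoc; ++-identityʳ; length-++; length-replicate; ∷-injective; ∷ʳ-injectiveʳ; map-cong; map-∘; map-++; length-map; length-tabulate; take++drop≡id; ++-conicalʳ)
open import Data.List.Relation.Binary.Infix.Heterogeneous using (Infix; here; _++ⁱ_)
open import Data.List.Relation.Binary.Pointwise using (Pointwise-≡⇒≡; ≡⇒Pointwise-≡)
import Data.List.Relation.Binary.Prefix.Heterogeneous as Prefix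
import Data.List.Relation.Binary.Suffix.Heterogeneous as Suffix
open import Data.List.Relation.Unary.All as All using (All; []; _∷_)
import Data.List.Relation.Unary.All.Properties as All
open import Data.List.Relation.Unary.AllPairs using (_∷_)
open import Data.List.Relation.Unary.Any using (here; there)
open import Data.List.Relation.Unary.Unique.Propositional using (Unique)
import Data.List.Relation.Unary.Unique.Propositional.Properties as Unique
open import Data.Maybe.Base using (Maybe; just; nothing; maybe′)
open import Data.Nat.Base as ℕ using (ℕ; zero; suc; _∸_; z≤n; s≤s; NonTrivial; NonZero)
import Data.Nat.Coprimality as Coprimality
open import Data.Nat.Induction using (<-wellFounded)
open import Data.Nat.ListAction using (sum)
open import Data.Nat.ListAction.Properties using (sum-++)
open import Data.Nat.Properties as ℕ using (module ≤-Reasoning)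
open import Data.Nat.Tactic.RingSolver using (solve-∀)
open import Data.Product.Base using (Σ; ∃; ∃₂; _×_; _,_; proj₁; proj₂)
import Data.Rational.Properties as ℚ
open import Data.Rational.Solver using (module +-*-Solver)
open import Data.Sum.Base using (_⊎_; inj₁; inj₂)
import Data.Vec.Base as Vec
open import Function.Base using (_∘_)
open import Function.Bundles using (_↔_; Inverse; Injection)
open import Function.Properties.Inverse using (↔⇒↣; ↔-sym)
open import Induction.WellFounded using (Acc; acc)
open import Relation.Binary.Definitions using (DecidableEquality)
open import Relation.Binary.PropositionalEquality using (_≡_; _≢_; refl; sym; trans; cong; cong₂; subst; subst₂; module ≡-Reasoning)
open import Relation.Nullary using (¬_; Dec; yes; no; does; contradiction)
open import Algebra.Properties.CommutativeSemigroup ℕ.+-commutativeSemigroup using () renaming (interchange to +-interchange)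

-- Borders

module _ {A : Set} where
  open import Data.Nat.Base using (_+_; _≤_; _<_)

  ++-compare : ∀ (as cs : List A) {bs ds} → as ++ bs ≡ cs ++ ds →
               length as ≤ length cs → ∃ λ es → cs ≡ as ++ es × bs ≡ es ++ ds
  ++-compare []       cs       eq _         = cs , refl , eq
  ++-compare (a ∷ as) (c ∷ cs) eq (s≤s as≤cs)
    with refl , eq′ ← ∷-injective eq
    with es , refl , eq″ ← ++-compare as cs eq′ as≤cs = es , refl , eq″

  ++-dropsˡ-< : ∀ (ys ws : List A) → ys ≢ [] → length ws < length (ys ++ ws)
  ++-dropsˡ-< []       ws ys≢[] = contradiction refl ys≢[]
  ++-dropsˡ-< (y ∷ ys) ws _     =
    s≤s (subst (length ws ≤_) (sym (length-++ ys)) (ℕ.m≤n+m _ (length ys)))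

  -- A border overlapping itself has a border, which is a shorter border of the whole.
  nonOverlapping : ∀ {F : List A} U Y Z → Acc _<_ (length U) → U ≢ [] → Y ≢ [] →
                   F ≡ U ++ Z → F ≡ Y ++ U →
                   ∃₂ λ U W → U ≢ [] × F ≡ (U ++ W) ++ U
  nonOverlapping U Y Z (acc rec) U≢[] Y≢[] F≡UZ F≡YU with ℕ.≤-total (length U) (length Y)
  ... | inj₁ U≤Y with W , refl , _ ← ++-compare U Y (trans (sym F≡UZ) F≡YU) U≤Y =
    U , W , U≢[] , F≡YU
  ... | inj₂ Y≤U with ++-compare Y U (trans (sym F≡YU) F≡UZ) Y≤U
  ...   | []        , U≡Y  , _    = U , [] , U≢[] ,
    trans F≡YU (cong (_++ U) (sym (trans (++-identityʳ U) (trans U≡Y (++-identityʳ Y)))))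
  ...   | W@(_ ∷ _) , U≡YW , U≡WZ =
    -- The overlap `W` of the two copies satisfies `U ≡ Y ++ W` and `U ≡ W ++ Z`, so `F` is both
    -- `W ++ (Z ++ Z)` and `(Y ++ Y) ++ W`; `W` is shorter than `U` because `Y` is non-empty.
    nonOverlapping W (Y ++ Y) (Z ++ Z)
      (rec (subst (λ V → length W < length V) (sym U≡YW) (++-dropsˡ-< Y W Y≢[])))
      (λ ()) (Y++Y≢[] Y Y≢[])
      (trans F≡UZ (trans (cong (_++ Z) U≡WZ) (++-assoc W Z Z)))
      (trans F≡YU (trans (cong (Y ++_) U≡YW) (sym (++-assoc Y Y W))))
    where
    Y++Y≢[] : ∀ (Y : List A) → Y ≢ [] → Y ++ Y ≢ []
    Y++Y≢[] []      Y≢[] _ = Y≢[] refl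
    Y++Y≢[] (_ ∷ _) _    ()

  border⇒nonOverlapping : ∀ {U F : List A} → Border U F →
                          ∃₂ λ U W → U ≢ [] × F ≡ (U ++ W) ++ U
  border⇒nonOverlapping {U} ((U≢[] , U≢F , pre) , suf) =
    let Z , F≡UZ = prefix⁻ pre
        Y , F≡YU = suffix⁻ suf
    in nonOverlapping U Y Z (<-wellFounded _) U≢[]
         (λ Y≡[] → U≢F (sym (trans F≡YU (cong (_++ U) Y≡[])))) F≡UZ F≡YU
    where
    prefix⁻ : ∀ {U F : List A} → Prefix.Prefix _≡_ U F → ∃ λ Z → F ≡ U ++ Z
    prefix⁻ pre with pw Prefix.++ Z ← Prefix.toView pre = Z , cong (_++ Z) (sym (Pointwise-≡⇒≡ pw))

    suffix⁻ : ∀ {U F : List A} → Suffix.Suffix _≡_ U F → ∃ λ Y → F ≡ Y ++ U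
    suffix⁻ suf with Y Suffix.++ pw ← Suffix.toView suf = Y , cong (Y ++_) (sym (Pointwise-≡⇒≡ pw))

  -- If `v` reached beyond `U ++ W`, then `r` would be a suffix of the last `U`, whence |v| ≤ |r| ≤
  -- |U|. This serves to place the last copy of a border entirely inside `r`.
  firstHalf : ∀ (v : List A) {r} U {W} → length v ≤ length r → v ++ r ≡ (U ++ W) ++ U →
              length v ≤ length (U ++ W)
  firstHalf v {r} U {W} v≤r eq with ℕ.≤-total (length v) (length (U ++ W))
  ... | inj₁ v≤UW = v≤UW
  ... | inj₂ UW≤v with es , _ , refl ← ++-compare (U ++ W) v (sym eq) UW≤v = begin
    length v             ≤⟨ v≤r ⟩
    length r             ≤⟨ ℕ.m≤n+m _ (length es) ⟩
    length es + length r ≡⟨ length-++ es ⟨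
    length U             ≤⟨ ℕ.m≤m+n _ (length W) ⟩
    length U + length W  ≡⟨ length-++ U ⟨
    length (U ++ W)      ∎
    where open ≤-Reasoning

  replicate-prefix-last : ∀ {x : A} t U {V} → replicate t x ≡ U ++ V → U ≢ [] →
                          ∃ λ U′ → U ≡ U′ ∷ʳ x
  replicate-prefix-last {x} t U eq U≢[] with initLast U
  ... | []       = contradiction refl U≢[]
  ... | U′ ∷ʳ′ y with refl ∷ _ ← All.++⁻ʳ U′ (All.++⁻ˡ (U′ ∷ʳ y)
                        (subst (All (x ≡_)) eq (All.replicate⁺ t refl))) = U′ , refl

  endsNotIn : ∀ {x y : A} → x ≢ y → DecidableEquality A → (r : List A) →
             (∀ r′ → r ≢ r′ ∷ʳ x) ⊎ (∀ r′ → r ≢ r′ ∷ʳ y)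
  endsNotIn {x} {y} x≢y _≟_ r with initLast r
  ... | []       = inj₁ λ { [] () ; (_ ∷ _) () }
  ... | r₀ ∷ʳ′ a with a ≟ x
  ...   | no  a≢x  = inj₁ λ r′ eq → a≢x (∷ʳ-injectiveʳ r₀ r′ eq)
  ...   | yes refl = inj₂ λ r′ eq → x≢y (∷ʳ-injectiveʳ r₀ r′ eq)

  drop-length-++ : ∀ (p s : List A) → drop (length p) (p ++ s) ≡ s
  drop-length-++ []      s = refl
  drop-length-++ (_ ∷ p) s = drop-length-++ p s

  take-length-++ : ∀ (p s : List A) → take (length p) (p ++ s) ≡ p
  take-length-++ []      s = refl
  take-length-++ (a ∷ p) s = cong (a ∷_) (take-length-++ p s)

-- Sums

⟦_⟧ : {P : Set} → Dec P → ℕ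
⟦ d ⟧ = if does d then 1 else 0

⟦⟧-yes : ∀ {P : Set} (d : Dec P) → P → ⟦ d ⟧ ≡ 1
⟦⟧-yes (yes _) _ = refl
⟦⟧-yes (no ¬p) p = contradiction p ¬p

⟦⟧-no : ∀ {P : Set} (d : Dec P) → ¬ P → ⟦ d ⟧ ≡ 0
⟦⟧-no (yes p) ¬p = contradiction p ¬p
⟦⟧-no (no _)  _  = refl

⟦⟧≤1 : ∀ {P : Set} (d : Dec P) → ⟦ d ⟧ ℕ.≤ 1
⟦⟧≤1 (yes _) = s≤s z≤n
⟦⟧≤1 (no _)  = z≤n

module _ {X : Set} where
  open import Data.Nat.Base using (_+_; _*_; _≤_)

  sum-mono : ∀ {f g : X → ℕ} → (∀ x → f x ≤ g x) → ∀ xs → sum (map f xs) ≤ sum (map g xs)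
  sum-mono f≤g []       = z≤n
  sum-mono f≤g (x ∷ xs) = ℕ.+-mono-≤ (f≤g x) (sum-mono f≤g xs)

  sum-+ : ∀ (f g : X → ℕ) xs → sum (map (λ x → f x + g x) xs) ≡ sum (map f xs) + sum (map g xs)
  sum-+ f g []       = refl
  sum-+ f g (x ∷ xs) = trans (cong (f x + g x +_) (sum-+ f g xs)) (+-interchange (f x) (g x) _ _)

  sum-* : ∀ c (f : X → ℕ) xs → sum (map (λ x → c * f x) xs) ≡ c * sum (map f xs)
  sum-* c f []       = sym (ℕ.*-zeroʳ c)
  sum-* c f (x ∷ xs) = trans (cong (c * f x +_) (sum-* c f xs)) (sym (ℕ.*-distribˡ-+ c (f x) _))

  sum-const : ∀ c (xs : List X) → sum (map (λ _ → c) xs) ≡ length xs * c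
  sum-const c []       = refl
  sum-const c (_ ∷ xs) = cong (c +_) (sum-const c xs)

  module _ (_≟_ : DecidableEquality X) where

    sum-⟦≟⟧-∉ : ∀ {x} {xs : List X} → All (x ≢_) xs → sum (map (λ a → ⟦ a ≟ x ⟧) xs) ≡ 0
    sum-⟦≟⟧-∉ []            = refl
    sum-⟦≟⟧-∉ {x} (x≢a ∷ x∉) = cong₂ _+_ (⟦⟧-no (_ ≟ x) (x≢a ∘ sym)) (sum-⟦≟⟧-∉ x∉)

    sum-⟦≟⟧-∈ : ∀ {x} {xs : List X} → Unique xs → x ∈ xs → sum (map (λ a → ⟦ a ≟ x ⟧) xs) ≡ 1
    sum-⟦≟⟧-∈ {x} (x∉ ∷ _)  (here refl) = cong₂ _+_ (⟦⟧-yes (x ≟ x) refl) (sum-⟦≟⟧-∉ x∉)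
    sum-⟦≟⟧-∈ {x} (a∉ ∷ u)  (there x∈)  = cong₂ _+_ (⟦⟧-no (_ ≟ x) (All.lookup a∉ x∈)) (sum-⟦≟⟧-∈ u x∈)

sum-cartesianProductWith : ∀ {X Y Z : Set} (f : Z → ℕ) (_∙_ : X → Y → Z) xs ys →
  sum (map f (cartesianProductWith _∙_ xs ys)) ≡ sum (map (λ x → sum (map (λ y → f (x ∙ y)) ys)) xs)
sum-cartesianProductWith f _∙_ []       ys = refl
sum-cartesianProductWith f _∙_ (x ∷ xs) ys = begin
  sum (map f (map (x ∙_) ys ++ zs))             ≡⟨ cong sum (map-++ f (map (x ∙_) ys) zs) ⟩
  sum (map f (map (x ∙_) ys) ++ map f zs)       ≡⟨ sum-++ (map f (map (x ∙_) ys)) _ ⟩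
  sum (map f (map (x ∙_) ys)) ℕ.+ sum (map f zs)
    ≡⟨ cong₂ ℕ._+_ (cong sum (sym (map-∘ ys))) (sum-cartesianProductWith f _∙_ xs ys) ⟩
  _ ∎
  where
  open ≡-Reasoning
  zs = cartesianProductWith _∙_ xs ys

-- Elementary inequalities for powers

module _ where
  open import Data.Nat.Base using (_+_; _*_; _^_; _≤_; _<_)

  n<2^n : ∀ n → n < 2 ^ n
  n<2^n zero    = s≤s z≤n
  n<2^n (suc n) = begin-strict
    suc n              ≡⟨ ℕ.+-comm 1 n ⟩
    n + 1              <⟨ ℕ.+-mono-<-≤ (n<2^n n) (ℕ.m^n>0 2 n) ⟩
    2 ^ n + 2 ^ n      ≡⟨ cong (2 ^ n +_) (ℕ.+-identityʳ (2 ^ n)) ⟨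
    2 * 2 ^ n          ∎
    where open ≤-Reasoning

  -- Bernoulli's inequality 1 + m/R ≤ (1 + 1/R)ᵐ, multiplied by Rᵐ⁺¹ so that it stays within the
  -- natural numbers.
  bernoulli : ∀ R m → R ^ m * (R + m) ≤ suc R ^ m * R
  bernoulli R zero    = ℕ.≤-reflexive (cong (1 *_) (ℕ.+-identityʳ R))
  bernoulli R (suc m) = begin
    R * R ^ m * (R + suc m)        ≤⟨ ℕ.m≤m+n _ (R ^ m * m) ⟩
    R * R ^ m * (R + suc m) + R ^ m * m ≡⟨ lhs R (R ^ m) m ⟩
    suc R * (R ^ m * (R + m))      ≤⟨ ℕ.*-monoʳ-≤ (suc R) (bernoulli R m) ⟩
    suc R * (suc R ^ m * R)        ≡⟨ ℕ.*-assoc (suc R) (suc R ^ m) R ⟨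
    suc R * suc R ^ m * R          ∎
    where
    open ≤-Reasoning
    lhs : ∀ R X m → R * X * (R + suc m) + X * m ≡ suc R * (X * (R + m))
    lhs = solve-∀

  -- Bernoulli's inequality with exponent `e * R`, where `R + m` is at least `e * R`. In terms of
  -- chance: `e * R` independent trials, each failing with probability R/(R+1), all fail with
  -- probability at most 1/e.
  powers-ratio : ∀ e R .{{_ : NonZero R}} → e * R ^ (e * R) ≤ suc R ^ (e * R)
  powers-ratio e R = ℕ.*-cancelʳ-≤ _ _ R (begin
    e * R ^ m * R       ≡⟨ swap e (R ^ m) R ⟩
    R ^ m * (e * R)     ≤⟨ ℕ.*-monoʳ-≤ (R ^ m) (ℕ.m≤n+m m R) ⟩
    R ^ m * (R + m)     ≤⟨ bernoulli R m ⟩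
    suc R ^ m * R       ∎)
    where
    open ≤-Reasoning
    m = e * R
    swap : ∀ e X R → e * X * R ≡ X * (e * R)
    swap = solve-∀

  -- t * R blocks of length t = 4q, where R = σ ^ t ∸ 1: the chance that all of them differ
  -- from a given word is at most 1/t by powers-ratio.
  window : ℕ → ℕ → ℕ
  window σ q = 4 * q * (σ ^ (4 * q) ∸ 1) * (4 * q)

-- Sums over all strings of a given length

module Counting {A : Set} (_≟_ : DecidableEquality A) (letters : List A)
                (σ : ℕ) (|letters|≡σ : length letters ≡ σ)
                (once : ∀ x → sum (map (λ a → ⟦ a ≟ x ⟧) letters) ≡ 1) where
  open import Data.Nat.Base using (_+_; _*_; _^_; _≤_; _<_)

  _≟*_ : DecidableEquality (List A)
  _≟*_ = ≡-dec _≟_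

  -- An unnormalised expectation, defined by recursion on lists rather than through the enumeration
  -- `strings` of vectors, so that cutting a string into two independent parts follows by plain
  -- induction.
  ∑ : ℕ → (List A → ℕ) → ℕ
  ∑ zero    f = f []
  ∑ (suc n) f = sum (map (λ a → ∑ n (λ s → f (a ∷ s))) letters)

  sum-strings : ∀ n f → sum (map (λ S → f (Vec.toList S)) (strings letters n)) ≡ ∑ n f
  sum-strings zero    f = ℕ.+-identityʳ (f [])
  sum-strings (suc n) f = trans
    (sum-cartesianProductWith (λ S → f (Vec.toList S)) Vec._∷_ letters (strings letters n))
    (cong sum (map-cong (λ a → sum-strings n (λ s → f (a ∷ s))) letters))

  ∑-mono : ∀ n {f g} → (∀ s → length s ≡ n → f s ≤ g s) → ∑ n f ≤ ∑ n g
  ∑-mono zero    f≤g = f≤g [] refl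
  ∑-mono (suc n) f≤g = sum-mono (λ a → ∑-mono n λ s |s| → f≤g (a ∷ s) (cong suc |s|)) letters

  ∑-cong : ∀ n {f g} → (∀ s → length s ≡ n → f s ≡ g s) → ∑ n f ≡ ∑ n g
  ∑-cong n f≡g = ℕ.≤-antisym (∑-mono n λ s |s| → ℕ.≤-reflexive (f≡g s |s|))
                             (∑-mono n λ s |s| → ℕ.≤-reflexive (sym (f≡g s |s|)))

  ∑-+ : ∀ n f g → ∑ n (λ s → f s + g s) ≡ ∑ n f + ∑ n g
  ∑-+ zero    f g = refl
  ∑-+ (suc n) f g = trans (cong sum (map-cong (λ a → ∑-+ n _ _) letters)) (sum-+ _ _ letters)

  ∑-* : ∀ n c f → ∑ n (λ s → c * f s) ≡ c * ∑ n f
  ∑-* zero    c f = refl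
  ∑-* (suc n) c f = trans (cong sum (map-cong (λ a → ∑-* n c _) letters)) (sum-* c _ letters)

  ∑-const : ∀ n c → ∑ n (λ _ → c) ≡ σ ^ n * c
  ∑-const zero    c = sym (ℕ.*-identityˡ c)
  ∑-const (suc n) c = trans (cong sum (map-cong (λ a → ∑-const n c) letters))
                        (trans (trans (sum-const _ letters) (cong (_* (σ ^ n * c)) |letters|≡σ)) (sym (ℕ.*-assoc σ (σ ^ n) c)))

  ∑-split : ∀ m n f → ∑ (m + n) f ≡ ∑ m (λ p → ∑ n (λ s → f (p ++ s)))
  ∑-split zero    n f = refl
  ∑-split (suc m) n f = cong sum (map-cong (λ a → ∑-split m n _) letters)

  ∑-⟦≟⟧ : ∀ n w → ∑ n (λ s → ⟦ s ≟* w ⟧) ≡ ⟦ n ℕ.≟ length w ⟧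
  ∑-⟦≟⟧ zero    []      = refl
  ∑-⟦≟⟧ zero    (_ ∷ _) = refl
  ∑-⟦≟⟧ (suc n) []      = trans (∑-const (suc n) 0) (ℕ.*-zeroʳ (σ ^ suc n))
  ∑-⟦≟⟧ (suc n) (y ∷ w) = begin
    sum (map (λ a → ∑ n (λ s → ⟦ (a ∷ s) ≟* (y ∷ w) ⟧)) letters)
      ≡⟨ cong sum (map-cong first letters) ⟩
    sum (map (λ a → c * ⟦ a ≟ y ⟧) letters)  ≡⟨ sum-* c _ letters ⟩
    c * sum (map (λ a → ⟦ a ≟ y ⟧) letters)  ≡⟨ cong (c *_) (once y) ⟩
    c * 1                                    ≡⟨ ℕ.*-identityʳ c ⟩
    c                                        ≡⟨ ∑-⟦≟⟧ n w ⟩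
    ⟦ suc n ℕ.≟ suc (length w) ⟧             ∎
    where
    open ≡-Reasoning
    c = ∑ n (λ s → ⟦ s ≟* w ⟧)
    first : ∀ a → ∑ n (λ s → ⟦ (a ∷ s) ≟* (y ∷ w) ⟧) ≡ c * ⟦ a ≟ y ⟧
    first a with a ≟ y
    ... | yes _ = sym (ℕ.*-identityʳ c)
    ... | no  _ = trans (∑-const n 0) (trans (ℕ.*-zeroʳ (σ ^ n)) (sym (ℕ.*-zeroʳ c)))

  ∑< : ℕ → (ℕ → ℕ) → ℕ
  ∑< zero    f = 0
  ∑< (suc m) f = ∑< m f + f m

  term≤∑< : ∀ {j} m f → j < m → f j ≤ ∑< m f
  term≤∑< (suc m) f j<1+m with ℕ.m≤n⇒m<n∨m≡n (ℕ.≤-pred j<1+m)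
  ... | inj₁ j<m  = ℕ.≤-trans (term≤∑< m f j<m) (ℕ.m≤m+n _ _)
  ... | inj₂ refl = ℕ.m≤n+m _ _

  -- The bound on the first `m` sums and the bound on the next one are both `σ ^ m`, and together
  -- they fit into `σ ^ suc m` because σ ≥ 2.
  ∑-∑<-geometric : 2 ≤ σ → ∀ n m (f : ℕ → List A → ℕ) → (∀ j → j < m → ∑ n (f j) ≤ σ ^ j) →
                   ∑ n (λ s → ∑< m (λ j → f j s)) ≤ σ ^ m
  ∑-∑<-geometric 2≤σ n zero    f _  = ℕ.≤-trans (ℕ.≤-reflexive (trans (∑-const n 0) (ℕ.*-zeroʳ (σ ^ n)))) z≤n
  ∑-∑<-geometric 2≤σ n (suc m) f f≤ = begin
    ∑ n (λ s → ∑< m (λ j → f j s) + f m s)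
      ≡⟨ ∑-+ n _ _ ⟩
    ∑ n (λ s → ∑< m (λ j → f j s)) + ∑ n (f m)
      ≤⟨ ℕ.+-mono-≤ (∑-∑<-geometric 2≤σ n m f λ j j<m → f≤ j (ℕ.m<n⇒m<1+n j<m)) (f≤ m ℕ.≤-refl) ⟩
    σ ^ m + σ ^ m
      ≡⟨ cong (σ ^ m +_) (sym (ℕ.+-identityʳ (σ ^ m))) ⟩
    2 * σ ^ m
      ≤⟨ ℕ.*-monoˡ-≤ (σ ^ m) 2≤σ ⟩
    σ * σ ^ m ∎
    where open ≤-Reasoning

  -- Long borders

  -- Indicates, for a non-empty suffix of `r` after its first `j` letters, that this suffix is a
  -- border of `v ++ r` whose two copies do not overlap: it is compared only with the text preceding
  -- it. If that text is too short, the value is 0.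
  recurs : List A → ℕ → List A → ℕ
  recurs v j r = ⟦ drop j r ≟* take (length (drop j r)) (v ++ take j r) ⟧

  -- Given the first j letters of r, at most one continuation recurs.
  ∑-recurs : ∀ v j k → ∑ (j + k) (recurs v j) ≤ σ ^ j
  ∑-recurs v j k = begin
    ∑ (j + k) (recurs v j)                       ≡⟨ ∑-split j k _ ⟩
    ∑ j (λ p → ∑ k (λ s → recurs v j (p ++ s)))  ≤⟨ ∑-mono j atMostOne ⟩
    ∑ j (λ _ → 1)                                ≡⟨ ∑-const j 1 ⟩
    σ ^ j * 1                                    ≡⟨ ℕ.*-identityʳ _ ⟩
    σ ^ j                                        ∎
    where
    open ≤-Reasoning
    atMostOne : ∀ p → length p ≡ j → ∑ k (λ s → recurs v j (p ++ s)) ≤ 1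
    atMostOne p refl = begin
      ∑ k (λ s → recurs v j (p ++ s))         ≡⟨ ∑-cong k determined ⟩
      ∑ k (λ s → ⟦ s ≟* take k (v ++ p) ⟧)    ≡⟨ ∑-⟦≟⟧ k (take k (v ++ p)) ⟩
      ⟦ k ℕ.≟ length (take k (v ++ p)) ⟧      ≤⟨ ⟦⟧≤1 (k ℕ.≟ length (take k (v ++ p))) ⟩
      1                                       ∎
      where
      determined : ∀ s → length s ≡ k → recurs v (length p) (p ++ s) ≡ ⟦ s ≟* take k (v ++ p) ⟧
      determined s refl rewrite drop-length-++ p s | take-length-++ p s = refl

  -- Position j corresponds to a border of length |r| ∸ j, so j < |r| ∸ t selects the lengths above t.
  longBorders : ℕ → List A → List A → ℕ
  longBorders t v r = ∑< (length r ∸ t) (λ j → recurs v j r)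

  -- A union bound over the position `j` where the border starts, each position contributing at most
  -- `σ ^ j`. For t ≤ n the result is a fraction σ⁻ᵗ of all strings `r`.
  ∑-longBorders : 2 ≤ σ → ∀ t v n → ∑ n (longBorders t v) ≤ σ ^ (n ∸ t)
  ∑-longBorders 2≤σ t v n = ℕ.≤-trans
    (∑-mono n λ { r refl → ℕ.≤-refl })
    (∑-∑<-geometric 2≤σ n (n ∸ t) (recurs v) λ j j<n∸t →
      subst (λ n → ∑ n (recurs v j) ≤ σ ^ j)
        (ℕ.m+[n∸m]≡n (ℕ.≤-trans (ℕ.<⇒≤ j<n∸t) (ℕ.m∸n≤m n t))) (∑-recurs v j (n ∸ j)))

  -- A border of v ++ r no longer than t would be a power of x, but r does not end in x.
  unbordered : ∀ {x} t v₁ r → let v = replicate t x ++ v₁ in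
               length v ≤ length r → (∀ r′ → r ≢ r′ ∷ʳ x) → longBorders t v r ≡ 0 →
               Unbordered (v ++ r)
  unbordered {x} t v₁ r v≤r ¬r∷ʳx none _ border
    with U , W , U≢[] , vr≡UWU ← border⇒nonOverlapping border
    -- By `firstHalf`, `v` ends no later than the last `U` begins; with `p` the text between them,
    -- `r` is `p ++ U`.
    with p , UW≡vp , refl ← ++-compare (replicate t x ++ v₁) (U ++ W) vr≡UWU (firstHalf (replicate t x ++ v₁) U v≤r vr≡UWU)
    with length U ℕ.≤? t
  ... | yes U≤t
    with es , eq , _ ← ++-compare U (replicate t x) (trans UW≡vp (++-assoc (replicate t x) v₁ p))
                         (subst (length U ≤_) (sym (length-replicate t)) U≤t)
    with U′ , refl ← replicate-prefix-last t U eq U≢[] = ¬r∷ʳx (p ++ U′) (sym (++-assoc p U′ _))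
  -- A border longer than `t` is counted by `longBorders` at position |p|.
  ... | no U≰t = contradiction (ℕ.≤-trans (ℕ.≤-reflexive (sym recurs≡1)) (term≤∑< _ _ p<r∸t))
                   (subst (λ n → ¬ 1 ≤ n) (sym none) λ ())
    where
    v = replicate t x ++ v₁
    recurs≡1 : recurs v (length p) (p ++ U) ≡ 1
    recurs≡1 rewrite drop-length-++ p U | take-length-++ p U | sym UW≡vp | take-length-++ U W =
      ⟦⟧-yes (U ≟* U) refl
    p<r∸t : length p < length (p ++ U) ∸ t
    p<r∸t = ℕ.m+n≤o⇒m≤o∸n (suc (length p))
      (subst₂ _≤_ (ℕ.+-suc (length p) t) (sym (length-++ p)) (ℕ.+-monoʳ-≤ (length p) (ℕ.≰⇒> U≰t)))

  -- Searching for a run of one letter.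

  -- Only the m aligned blocks are inspected: they are independent, unlike overlapping occurrences.
  seek : A → ℕ → ℕ → List A → Maybe (List A)
  seek x t zero    h = nothing
  seek x t (suc m) h =
    if does (take t h ≟* replicate t x) then just h else seek x t m (drop t h)

  seek-just : ∀ x t m h {v} → seek x t m h ≡ just v →
              ∃₂ λ h₀ v₁ → h ≡ h₀ ++ v × v ≡ replicate t x ++ v₁
  seek-just x t (suc m) h eq with take t h ≟* replicate t x
  seek-just x t (suc m) h refl | yes tx =
    [] , drop t h , refl , trans (sym (take++drop≡id t h)) (cong (_++ drop t h) tx)
  ... | no _ with h₀ , v₁ , h≡ , v≡ ← seek-just x t m (drop t h) eq =
    take t h ++ h₀ , v₁ ,
    trans (sym (take++drop≡id t h)) (trans (cong (take t h ++_) h≡) (sym (++-assoc (take t h) h₀ _))) , v≡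

  isNothing : Maybe (List A) → ℕ
  isNothing = maybe′ (λ _ → 0) 1

  -- Each of the `m` blocks can differ from xᵗ in `R` ways, and the choices multiply.
  ∑-seek : ∀ {R} x t m → σ ^ t ≡ suc R → ∑ (m * t) (λ h → isNothing (seek x t m h)) ≤ R ^ m
  ∑-seek {R} x t zero    _  = ℕ.≤-refl
  ∑-seek {R} x t (suc m) σ^t = begin
    ∑ (t + m * t) (λ h → isNothing (seek x t (suc m) h))
      ≡⟨ ∑-split t (m * t) _ ⟩
    ∑ t (λ w → ∑ (m * t) (λ h → isNothing (seek x t (suc m) (w ++ h))))
      ≤⟨ ∑-mono t firstBlock ⟩
    ∑ t (λ w → R ^ m * (1 ∸ ⟦ w ≟* xs ⟧))
      ≡⟨ ∑-* t (R ^ m) _ ⟩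
    R ^ m * ∑ t (λ w → 1 ∸ ⟦ w ≟* xs ⟧)
      ≡⟨ cong (R ^ m *_) others ⟩
    R ^ m * R
      ≡⟨ ℕ.*-comm (R ^ m) R ⟩
    R * R ^ m ∎
    where
    open ≤-Reasoning
    xs = replicate t x
    firstBlock : ∀ w → length w ≡ t →
      ∑ (m * t) (λ h → isNothing (seek x t (suc m) (w ++ h))) ≤ R ^ m * (1 ∸ ⟦ w ≟* xs ⟧)
    firstBlock w refl = begin
      ∑ (m * t) (λ h → isNothing (seek x t (suc m) (w ++ h)))
        ≡⟨ ∑-cong (m * t) (λ h _ → split h) ⟩
      ∑ (m * t) (λ h → c * isNothing (seek x t m h))
        ≡⟨ ∑-* (m * t) c _ ⟩
      c * ∑ (m * t) (λ h → isNothing (seek x t m h))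
        ≤⟨ ℕ.*-monoʳ-≤ c (∑-seek x t m σ^t) ⟩
      c * R ^ m
        ≡⟨ ℕ.*-comm c (R ^ m) ⟩
      R ^ m * c ∎
      where
      -- The indicator that the first block misses; failure of the whole search is this factor times
      -- failure on the remaining blocks.
      c = 1 ∸ ⟦ w ≟* xs ⟧
      split : ∀ h → isNothing (seek x (length w) (suc m) (w ++ h)) ≡ c * isNothing (seek x (length w) m h)
      split h rewrite take-length-++ w h | drop-length-++ w h with w ≟* replicate (length w) x
      ... | yes _ = refl
      ... | no  _ = sym (ℕ.+-identityʳ _)
    others : ∑ t (λ w → 1 ∸ ⟦ w ≟* xs ⟧) ≡ R
    others = ℕ.suc-injective (begin-equality
      1 + ∑ t (λ w → 1 ∸ ⟦ w ≟* xs ⟧)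
        ≡⟨ cong (_+ ∑ t (λ w → 1 ∸ ⟦ w ≟* xs ⟧)) (sym (trans (∑-⟦≟⟧ t xs) (⟦⟧-yes (t ℕ.≟ length xs) (sym (length-replicate t))))) ⟩
      ∑ t (λ w → ⟦ w ≟* xs ⟧) + ∑ t (λ w → 1 ∸ ⟦ w ≟* xs ⟧)
        ≡⟨ ∑-+ t _ _ ⟨
      ∑ t (λ w → ⟦ w ≟* xs ⟧ + (1 ∸ ⟦ w ≟* xs ⟧))
        ≡⟨ ∑-cong t (λ w _ → ℕ.m+[n∸m]≡n (⟦⟧≤1 (w ≟* xs))) ⟩
      ∑ t (λ _ → 1)
        ≡⟨ ∑-const t 1 ⟩
      σ ^ t * 1
        ≡⟨ trans (ℕ.*-identityʳ _) σ^t ⟩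
      suc R ∎)

  -- Strings on which the construction fails

  bad : A → ℕ → ℕ → List A → List A → ℕ
  bad x t m h r = maybe′ (λ v → longBorders t v r) 1 (seek x t m h)

  -- The two summands are the two ways to fail: no block of `h` is xᵗ, which `bad` counts as 1 for
  -- every `r`, or the `v` that was found gives a border longer than `t`.
  ∑-bad : 2 ≤ σ → ∀ {R} x t m n → σ ^ t ≡ suc R →
          ∑ (m * t) (λ h → ∑ n (bad x t m h)) ≤ σ ^ n * R ^ m + σ ^ (m * t) * σ ^ (n ∸ t)
  ∑-bad 2≤σ {R} x t m n σ^t = begin
    ∑ (m * t) (λ h → ∑ n (bad x t m h))
      ≤⟨ ∑-mono (m * t) (λ h _ → bound h) ⟩
    ∑ (m * t) (λ h → σ ^ n * isNothing (seek x t m h) + σ ^ (n ∸ t))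
      ≡⟨ ∑-+ (m * t) _ _ ⟩
    ∑ (m * t) (λ h → σ ^ n * isNothing (seek x t m h)) + ∑ (m * t) (λ _ → σ ^ (n ∸ t))
      ≡⟨ cong₂ _+_ (∑-* (m * t) (σ ^ n) _) (∑-const (m * t) _) ⟩
    σ ^ n * ∑ (m * t) (λ h → isNothing (seek x t m h)) + σ ^ (m * t) * σ ^ (n ∸ t)
      ≤⟨ ℕ.+-monoˡ-≤ _ (ℕ.*-monoʳ-≤ (σ ^ n) (∑-seek x t m σ^t)) ⟩
    σ ^ n * R ^ m + σ ^ (m * t) * σ ^ (n ∸ t) ∎
    where
    open ≤-Reasoning
    bound : ∀ h → ∑ n (bad x t m h) ≤ σ ^ n * isNothing (seek x t m h) + σ ^ (n ∸ t)
    bound h with seek x t m h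
    ... | nothing = ℕ.≤-trans (ℕ.≤-reflexive (∑-const n 1)) (ℕ.m≤m+n _ _)
    ... | just v  = ℕ.≤-trans (∑-longBorders 2≤σ t v n) (ℕ.m≤n+m _ _)

  -- A failed search would give the value 1, so some `v` exists with `h ≡ h₀ ++ v`, and `v ++ r` is
  -- an unbordered factor. The hypothesis |h| ≤ |r| supplies |v| ≤ |r|.
  bad≡0⇒length≤b : ∀ x t m h r → length h ≤ length r → r ≢ [] → (∀ r′ → r ≢ r′ ∷ʳ x) →
                   bad x t m h r ≡ 0 → length r ≤ b _≟_ (h ++ r)
  bad≡0⇒length≤b x t m h r h≤r r≢[] ¬r∷ʳx bad≡0 with seek x t m h in eq
  ... | just v with h₀ , v₁ , refl , refl ← seek-just x t m h eq =
    ℕ.≤-trans (≤-length-++ v r)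
      (maximalUnborderedFactor-longest _≟_
        ( (λ vr≡[] → r≢[] (++-conicalʳ v r vr≡[]))
        , subst (Infix _≡_ (v ++ r)) (sym (++-assoc h₀ v r)) (h₀ ++ⁱ here (Prefix.fromView
            (subst (Prefix.PrefixView _≡_ (v ++ r)) (++-identityʳ (v ++ r)) (≡⇒Pointwise-≡ refl Prefix.++ [])))))
        (unbordered t v₁ r (ℕ.≤-trans (≤-length-++ h₀ v) h≤r) ¬r∷ʳx bad≡0))
    where
    ≤-length-++ : ∀ (p s : List A) → length s ≤ length (p ++ s)
    ≤-length-++ p s = subst (length s ≤_) (sym (length-++ p)) (ℕ.m≤n+m _ (length p))

  module _ (x y : A) (x≢y : x ≢ y) (t m : ℕ) where

    -- The suitable letter depends on the last letter of `r`, so both are charged at once: if either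
    -- `bad` is positive, the last term already reaches |r|; if both vanish, the letter in which `r`
    -- does not end yields the factor.
    length≤b+bad : ∀ h r → length h ≤ length r →
                   length r ≤ b _≟_ (h ++ r) + length r * (bad x t m h r + bad y t m h r)
    length≤b+bad h []        _   = z≤n
    length≤b+bad h r@(_ ∷ _) h≤r with bad x t m h r in eqx | bad y t m h r in eqy
    ... | zero  | suc l = ℕ.≤-trans (ℕ.m≤m*n (length r) (suc l)) (ℕ.m≤n+m _ _)
    ... | suc k | l     = ℕ.≤-trans (ℕ.m≤m*n (length r) (suc (k + l))) (ℕ.m≤n+m _ _)
    ... | zero  | zero  = ℕ.≤-trans (longUnbordered (endsNotIn x≢y _≟_ r)) (ℕ.m≤m+n _ _)
      where
      longUnbordered : (∀ r′ → r ≢ r′ ∷ʳ x) ⊎ (∀ r′ → r ≢ r′ ∷ʳ y) → length r ≤ b _≟_ (h ++ r)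
      longUnbordered (inj₁ ¬x) = bad≡0⇒length≤b x t m h r h≤r (λ ()) ¬x eqx
      longUnbordered (inj₂ ¬y) = bad≡0⇒length≤b y t m h r h≤r (λ ()) ¬y eqy

  -- Choice of parameters and the counting bound

  module _ {x y : A} (x≢y : x ≢ y) (2≤σ : 2 ≤ σ) (q : ℕ) .{{_ : NonZero q}} where

    private
      t R m K : ℕ
      -- Two letters with two ways to fail each, every one of probability at most 1/t, add up to
      -- 1/q.
      t = 4 * q
      R = σ ^ t ∸ 1
      m = t * R
      K = window σ q

      instance
        t≢0 : NonZero t
        t≢0 = ℕ.m*n≢0 4 q

      t<σ^t : t < σ ^ t
      t<σ^t = ℕ.<-≤-trans (n<2^n t) (ℕ.^-monoˡ-≤ t 2≤σ)

      σ^t≡1+R : σ ^ t ≡ suc R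
      σ^t≡1+R = sym (ℕ.m+[n∸m]≡n (ℕ.≤-trans (s≤s z≤n) t<σ^t))

      instance
        R≢0 : NonZero R
        R≢0 = ℕ.>-nonZero (ℕ.≤-pred (subst (2 ≤_) σ^t≡1+R (ℕ.≤-trans (s≤s (ℕ.>-nonZero⁻¹ t)) t<σ^t)))

        m≢0 : NonZero m
        m≢0 = ℕ.m*n≢0 t R

      t≤K : t ≤ K
      t≤K = ℕ.m≤n*m t m

    -- Both terms of `∑-bad` are at most a fraction 1/t: the missing run by `powers-ratio` with
    -- `m = t * R`, the long border because t < σᵗ.
    ∑-bad-small : ∀ z n → K ≤ n → t * ∑ K (λ h → ∑ n (bad z t m h)) ≤ 2 * σ ^ (K + n)
    ∑-bad-small z n K≤n = begin
      t * ∑ K (λ h → ∑ n (bad z t m h))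
        ≤⟨ ℕ.*-monoʳ-≤ t (∑-bad 2≤σ z t m n σ^t≡1+R) ⟩
      t * (σ ^ n * R ^ m + σ ^ K * σ ^ (n ∸ t))
        ≡⟨ distribute t (σ ^ n) (R ^ m) (σ ^ K) (σ ^ (n ∸ t)) ⟩
      t * R ^ m * σ ^ n + t * σ ^ (n ∸ t) * σ ^ K
        ≤⟨ ℕ.+-mono-≤ (ℕ.*-monoˡ-≤ (σ ^ n) noRun) (ℕ.*-monoˡ-≤ (σ ^ K) longBorder) ⟩
      σ ^ K * σ ^ n + σ ^ n * σ ^ K
        ≡⟨ double (σ ^ K) (σ ^ n) ⟩
      2 * (σ ^ K * σ ^ n)
        ≡⟨ cong (2 *_) (ℕ.^-distribˡ-+-* σ K n) ⟨
      2 * σ ^ (K + n) ∎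
      where
      open ≤-Reasoning
      distribute : ∀ t a b c d → t * (a * b + c * d) ≡ t * b * a + t * d * c
      distribute = solve-∀
      double : ∀ a b → a * b + b * a ≡ 2 * (a * b)
      double = solve-∀
      noRun : t * R ^ m ≤ σ ^ K
      noRun = begin
        t * R ^ m    ≤⟨ powers-ratio t R ⟩
        suc R ^ m    ≡⟨ cong (_^ m) σ^t≡1+R ⟨
        (σ ^ t) ^ m  ≡⟨ ℕ.^-*-assoc σ t m ⟩
        σ ^ (t * m)  ≡⟨ cong (σ ^_) (ℕ.*-comm t m) ⟩
        σ ^ K        ∎
      longBorder : t * σ ^ (n ∸ t) ≤ σ ^ n
      longBorder = begin
        t * σ ^ (n ∸ t)      ≤⟨ ℕ.*-monoˡ-≤ (σ ^ (n ∸ t)) (ℕ.<⇒≤ t<σ^t) ⟩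
        σ ^ t * σ ^ (n ∸ t)  ≡⟨ ℕ.^-distribˡ-+-* σ t (n ∸ t) ⟨
        σ ^ (t + (n ∸ t))    ≡⟨ cong (σ ^_) (ℕ.m+[n∸m]≡n (ℕ.≤-trans t≤K K≤n)) ⟩
        σ ^ n                ∎

    private
      B : ℕ → A → ℕ
      B n z = ∑ K (λ h → ∑ n (bad z t m h))

    ∑-bads-small : ∀ n → K ≤ n → q * (B n x + B n y) ≤ σ ^ (K + n)
    ∑-bads-small n K≤n = ℕ.*-cancelˡ-≤ 4 (begin
      4 * (q * (B n x + B n y))         ≡⟨ distribute q (B n x) (B n y) ⟩
      4 * q * B n x + 4 * q * B n y     ≤⟨ ℕ.+-mono-≤ (∑-bad-small x n K≤n) (∑-bad-small y n K≤n) ⟩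
      2 * N + 2 * N                     ≡⟨ double N ⟩
      4 * N                             ∎)
      where
      open ≤-Reasoning
      N = σ ^ (K + n)
      distribute : ∀ q a b → 4 * (q * (a + b)) ≡ 4 * q * a + 4 * q * b
      distribute = solve-∀
      double : ∀ a → 2 * a + 2 * a ≡ 4 * a
      double = solve-∀

    ∑-b-split : ∀ n → K ≤ n → σ ^ (K + n) * n ≤ ∑ (K + n) (b _≟_) + n * (B n x + B n y)
    ∑-b-split n K≤n = begin
      σ ^ (K + n) * n
        ≡⟨ ∑-const (K + n) n ⟨
      ∑ (K + n) (λ _ → n)
        ≡⟨ ∑-split K n _ ⟩
      ∑ K (λ h → ∑ n (λ _ → n))
        ≤⟨ ∑-mono K (λ h |h| → ∑-mono n (λ r |r| → pointwise h r |h| |r|)) ⟩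
      ∑ K (λ h → ∑ n (λ r → b _≟_ (h ++ r) + n * (bad x t m h r + bad y t m h r)))
        ≡⟨ ∑-cong K (λ h _ → trans (∑-+ n _ _) (cong (∑ n (λ r → b _≟_ (h ++ r)) +_)
             (trans (∑-* n n _) (cong (n *_) (∑-+ n _ _))))) ⟩
      ∑ K (λ h → ∑ n (λ r → b _≟_ (h ++ r)) + n * (∑ n (bad x t m h) + ∑ n (bad y t m h)))
        ≡⟨ trans (∑-+ K _ _) (cong₂ _+_ (sym (∑-split K n (b _≟_)))
             (trans (∑-* K n _) (cong (n *_) (∑-+ K _ _)))) ⟩
      ∑ (K + n) (b _≟_) + n * (B n x + B n y) ∎
      where
      open ≤-Reasoning
      pointwise : ∀ h r → length h ≡ K → length r ≡ n →
                  n ≤ b _≟_ (h ++ r) + n * (bad x t m h r + bad y t m h r)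
      pointwise h r |h| refl = length≤b+bad x y x≢y t m h r (subst (_≤ length r) (sym |h|) K≤n)

    -- Divided by `q * σ ^ n`, this says that the mean of `b` is at least n(1 - 1/q) - 2K. For n ≤
    -- 2K the constant absorbs everything; otherwise the string is cut with |h| = K and |r| ≥ K, at
    -- the cost of the K letters of `h`.
    ∑-b-large : ∀ n → q * (n * σ ^ n) ≤ q * ∑ n (b _≟_) + n * σ ^ n + q * (2 * K * σ ^ n)
    ∑-b-large n with ℕ.≤-total n (2 * K)
    ... | inj₁ n≤2K = ℕ.≤-trans (ℕ.*-monoʳ-≤ q (ℕ.*-monoˡ-≤ (σ ^ n) n≤2K)) (ℕ.m≤n+m _ _)
    ... | inj₂ 2K≤n = subst Goal (ℕ.m+[n∸m]≡n (ℕ.≤-trans (ℕ.m≤m+n K _) 2K≤n))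
                        (shifted (n ∸ K) (ℕ.m+n≤o⇒m≤o∸n K (subst (_≤ n) (cong (K +_) (ℕ.+-identityʳ K)) 2K≤n)))
      where
      open ≤-Reasoning
      Goal : ℕ → Set
      Goal n = q * (n * σ ^ n) ≤ q * ∑ n (b _≟_) + n * σ ^ n + q * (2 * K * σ ^ n)
      shifted : ∀ n → K ≤ n → Goal (K + n)
      shifted n K≤n = begin
        q * ((K + n) * N)
          ≡⟨ lhs q K n N ⟩
        q * (N * n) + q * (K * N)
          ≤⟨ ℕ.+-monoˡ-≤ _ (ℕ.*-monoʳ-≤ q (∑-b-split n K≤n)) ⟩
        q * (E + n * (B n x + B n y)) + q * (K * N)
          ≡⟨ mid q E n (B n x + B n y) (K * N) ⟩
        q * E + n * (q * (B n x + B n y)) + q * (K * N)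
          ≤⟨ ℕ.+-mono-≤ (ℕ.+-monoʳ-≤ (q * E) (ℕ.*-mono-≤ (ℕ.m≤n+m n K) (∑-bads-small n K≤n)))
               (ℕ.*-monoʳ-≤ q (ℕ.*-monoˡ-≤ N (ℕ.m≤m+n K _))) ⟩
        q * E + (K + n) * N + q * (2 * K * N) ∎
        where
        N = σ ^ (K + n)
        E = ∑ (K + n) (b _≟_)
        lhs : ∀ q K n N → q * ((K + n) * N) ≡ q * (N * n) + q * (K * N)
        lhs = solve-∀
        mid : ∀ q E n b k → q * (E + n * b) + q * k ≡ q * E + n * (q * b) + q * k
        mid = solve-∀

-- Rationals

open import Data.Integer.Base using (+_)
open import Data.Rational.Base using (ℚ; mkℚ; 1ℚ; _≤_; _+_; _*_; _-_; -_; _/_; Positive; NonNegative; *≤*)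

fromℕ≡mkℚ : ∀ n → fromℕ n ≡ mkℚ (+ n) 0 (Coprimality.sym (Coprimality.1-coprimeTo n))
fromℕ≡mkℚ n = ℚ.normalize-coprime (Coprimality.sym (Coprimality.1-coprimeTo n))

1/≡mkℚ : ∀ d-1 → + 1 / suc d-1 ≡ mkℚ (+ 1) d-1 (Coprimality.1-coprimeTo (suc d-1))
1/≡mkℚ d-1 = ℚ.normalize-coprime (Coprimality.1-coprimeTo (suc d-1))

1/-inverseˡ : ∀ d .{{_ : NonZero d}} → (+ 1 / d) * fromℕ d ≡ 1ℚ
1/-inverseˡ (suc d) rewrite fromℕ≡mkℚ (suc d) | 1/≡mkℚ d =
  ℚ.*-inverseˡ (mkℚ (+ suc d) 0 (Coprimality.sym (Coprimality.1-coprimeTo (suc d))))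

1/-nonNeg : ∀ d .{{_ : NonZero d}} → NonNegative (+ 1 / d)
1/-nonNeg d = ℚ.pos⇒nonNeg (+ 1 / d) {{ℚ.normalize-pos 1 d}}

fromℕ-+ : ∀ m n → fromℕ (m ℕ.+ n) ≡ fromℕ m + fromℕ n
fromℕ-+ m n rewrite fromℕ≡mkℚ m | fromℕ≡mkℚ n =
  cong (_/ 1) (sym (cong₂ ℤ._+_ (ℤ.*-identityʳ (+ m)) (ℤ.*-identityʳ (+ n))))

fromℕ-* : ∀ m n → fromℕ (m ℕ.* n) ≡ fromℕ m * fromℕ n
fromℕ-* m n rewrite fromℕ≡mkℚ m | fromℕ≡mkℚ n = cong (_/ 1) (ℤ.pos-* m n)

fromℕ-mono-≤ : ∀ {m n} → m ℕ.≤ n → fromℕ m ≤ fromℕ n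
fromℕ-mono-≤ {m} {n} m≤n rewrite fromℕ≡mkℚ m | fromℕ≡mkℚ n =
  *≤* (ℤ.*-monoʳ-≤-nonNeg (+ 1) (ℤ.+≤+ m≤n))

-- The numerator is at least 1, so the reciprocal of the denominator lies below `c`.
positive⇒1/≤ : ∀ c .{{_ : Positive c}} → ∃ λ q-1 → + 1 / suc q-1 ≤ c
positive⇒1/≤ c@(mkℚ ℤ.+[1+ p ] d-1 _) = d-1 , subst (_≤ c) (sym (1/≡mkℚ d-1))
  (*≤* (ℤ.*-monoʳ-≤-nonNeg (+ suc d-1) (ℤ.+≤+ (s≤s (z≤n {p})))))

-- Makes `ξ σ * (σ ^- 4)` positive, hence at least some 1/q. For σ ≥ 3 the numerator is non-zero
-- since σ² < σ³.
ξ-positive : ∀ σ .{{_ : NonTrivial σ}} → Positive (ξ σ)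
ξ-positive 2                       = _
ξ-positive σ@(suc (suc (suc k))) =
  ℚ.normalize-pos (2 ℕ.* σ ℕ.^ 3 ∸ 2 ℕ.* σ ℕ.^ 2) ((σ ∸ 2) ℕ.* (d ℕ.+ 2))
    {{ℕ.m*n≢0 (suc k) (d ℕ.+ 2) {{_}} {{subst NonZero (ℕ.+-comm 2 d) _}}}}
    {{ℕ.>-nonZero (ℕ.m<n⇒0<n∸m (ℕ.*-monoʳ-< 2 (ℕ.^-monoʳ-< σ (s≤s (s≤s z≤n)) (ℕ.n<1+n 2))))}}
  where d = σ ℕ.^ 2 ∸ 2 ℕ.* σ

-- Multiplying the hypothesis by 1/(qN).
rational-bound : ∀ n q N E K .{{_ : NonZero q}} .{{_ : NonZero N}} c → + 1 / q ≤ c →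
  q ℕ.* (n ℕ.* N) ℕ.≤ q ℕ.* E ℕ.+ n ℕ.* N ℕ.+ q ℕ.* (K ℕ.* N) →
  fromℕ n * (1ℚ - c) - fromℕ K ≤ (+ 1 / N) * fromℕ E
rational-bound n q N E K c u≤c hyp = begin
  n′ * (1ℚ - c) - K′
    ≡⟨ solve 3 (λ n c k → n :* (con 1ℚ :- c) :- k := n :- (c :* n :+ k)) refl n′ c K′ ⟩
  n′ - (c * n′ + K′)
    ≤⟨ ℚ.+-monoˡ-≤ (- (c * n′ + K′)) bound ⟩
  w * E′ + c * n′ + K′ - (c * n′ + K′)
    ≡⟨ solve 3 (λ a b k → a :+ b :+ k :- (b :+ k) := a) refl (w * E′) (c * n′) K′ ⟩
  w * E′ ∎
  where
  open ℚ.≤-Reasoning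
  open +-*-Solver
  u = + 1 / q
  w = + 1 / N
  n′ = fromℕ n
  q′ = fromℕ q
  N′ = fromℕ N
  E′ = fromℕ E
  K′ = fromℕ K
  uq≡1 : u * q′ ≡ 1ℚ
  uq≡1 = 1/-inverseˡ q
  wN≡1 : w * N′ ≡ 1ℚ
  wN≡1 = 1/-inverseˡ N
  instance
    uw≥0 : NonNegative (u * w)
    uw≥0 = ℚ.nonNeg*nonNeg⇒nonNeg u {{1/-nonNeg q}} w {{1/-nonNeg N}}
    n≥0 : NonNegative n′
    n≥0 = subst NonNegative (sym (fromℕ≡mkℚ n)) _
  hyp′ : q′ * (n′ * N′) ≤ q′ * E′ + n′ * N′ + q′ * (K′ * N′)
  hyp′ = subst₂ _≤_
    (trans (fromℕ-* q _) (cong (q′ *_) (fromℕ-* n N)))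
    (trans (fromℕ-+ (q ℕ.* E ℕ.+ n ℕ.* N) _)
      (cong₂ _+_ (trans (fromℕ-+ (q ℕ.* E) _) (cong₂ _+_ (fromℕ-* q E) (fromℕ-* n N)))
                 (trans (fromℕ-* q _) (cong (q′ *_) (fromℕ-* K N)))))
    (fromℕ-mono-≤ hyp)
  bound : n′ ≤ w * E′ + c * n′ + K′
  bound = begin
    n′
      ≡⟨ solve 1 (λ n → n := con 1ℚ :* con 1ℚ :* n) refl n′ ⟩
    1ℚ * 1ℚ * n′
      ≡⟨ cong₂ (λ a b → a * b * n′) (sym uq≡1) (sym wN≡1) ⟩
    (u * q′) * (w * N′) * n′
      ≡⟨ solve 5 (λ u w q n N → (u :* q) :* (w :* N) :* n := u :* w :* (q :* (n :* N))) refl u w q′ n′ N′ ⟩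
    u * w * (q′ * (n′ * N′))
      ≤⟨ ℚ.*-monoˡ-≤-nonNeg (u * w) hyp′ ⟩
    u * w * (q′ * E′ + n′ * N′ + q′ * (K′ * N′))
      ≡⟨ solve 7 (λ u w q n N E K → u :* w :* (q :* E :+ n :* N :+ q :* (K :* N))
           := (u :* q) :* (w :* E) :+ (w :* N) :* (u :* n) :+ (u :* q) :* (w :* N) :* K) refl u w q′ n′ N′ E′ K′ ⟩
    (u * q′) * (w * E′) + (w * N′) * (u * n′) + (u * q′) * (w * N′) * K′
      ≡⟨ cong₂ (λ a b → a * (w * E′) + b * (u * n′) + a * b * K′) uq≡1 wN≡1 ⟩
    1ℚ * (w * E′) + 1ℚ * (u * n′) + 1ℚ * 1ℚ * K′
      ≡⟨ solve 3 (λ a b k → con 1ℚ :* a :+ con 1ℚ :* b :+ con 1ℚ :* con 1ℚ :* k := a :+ b :+ k) refl (w * E′) (u * n′) K′ ⟩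
    w * E′ + u * n′ + K′
      ≤⟨ ℚ.+-monoˡ-≤ K′ (ℚ.+-monoʳ-≤ (w * E′) (ℚ.*-monoʳ-≤-nonNeg n′ u≤c)) ⟩
    w * E′ + c * n′ + K′ ∎

-- The bound for an arbitrary alphabet

lettersOf : ∀ {A : Set} {σ} → A ↔ Fin σ → List A
lettersOf {σ = σ} alphabet = map (Inverse.from alphabet) (allFin σ)

sum-b-large : ∀ {A : Set} {k} (alphabet : A ↔ Fin (2 ℕ.+ k)) q .{{_ : NonZero q}} n →
  let σ = 2 ℕ.+ k
      E = sum (map (λ S → b (inj⇒≟ (↔⇒↣ alphabet)) (Vec.toList S)) (strings (lettersOf alphabet) n))
  in q ℕ.* (n ℕ.* σ ℕ.^ n) ℕ.≤
     q ℕ.* E ℕ.+ n ℕ.* σ ℕ.^ n ℕ.+ q ℕ.* (2 ℕ.* window σ q ℕ.* σ ℕ.^ n)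
sum-b-large {A} {k} alphabet q n =
  subst (λ E → q ℕ.* (n ℕ.* σ ℕ.^ n) ℕ.≤
               q ℕ.* E ℕ.+ n ℕ.* σ ℕ.^ n ℕ.+ q ℕ.* (2 ℕ.* window σ q ℕ.* σ ℕ.^ n))
    -- The two fixed letters are those numbered 0 and 1.
    (sym (sum-strings n (b _≟_))) (∑-b-large zero≢one (s≤s (s≤s z≤n)) q n)
  where
  open Inverse alphabet using (to; from; strictlyInverseʳ)
  σ = 2 ℕ.+ k
  letters = lettersOf alphabet
  _≟_ : DecidableEquality A
  _≟_ = inj⇒≟ (↔⇒↣ alphabet)
  from-injective : ∀ {i j} → from i ≡ from j → i ≡ j
  from-injective = Injection.injective (↔⇒↣ (↔-sym alphabet))
  ∈-letters : ∀ x → x ∈ letters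
  ∈-letters x = subst (_∈ letters) (strictlyInverseʳ x) (∈-map⁺ from (∈-allFin (to x)))
  zero≢one : from zero ≢ from (suc zero)
  zero≢one eq = contradiction (from-injective eq) λ ()
  open Counting _≟_ letters σ
    (trans (length-map from (allFin σ)) (length-tabulate {n = σ} (λ i → i)))
    (λ x → sum-⟦≟⟧-∈ _≟_ (Unique.map⁺ from-injective (Unique.allFin⁺ σ)) (∈-letters x))

theorem2 : (σ : ℕ) .{{_ : NonTrivial σ}} →
    Σ ℚ (λ C → (A : Set) (alphabet : A ↔ Fin σ) (n : ℕ) → 1 ℕ.≤ n →
    fromℕ n * (1ℚ - ξ σ * (σ ^- 4)) - C ≤ expectedMaximalUnborderedFactorLength alphabet n)
-- The constant is twice the window length, with `q` the denominator of `ξ σ * (σ ^- 4)`; it is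
-- fixed before the alphabet and `n`.
theorem2 σ@(suc (suc _)) = fromℕ K , λ A alphabet n _ →
  rational-bound n q (σ ℕ.^ n)
    (sum (map (λ S → b (inj⇒≟ (↔⇒↣ alphabet)) (Vec.toList S)) (strings (lettersOf alphabet) n)))
    K {{_}} {{ℕ.m^n≢0 σ n}} c (proj₂ 1/q≤c) (sum-b-large alphabet q n)
  where
  c = ξ σ * (σ ^- 4)
  c-positive : Positive c
  c-positive = ℚ.pos*pos⇒pos (ξ σ) {{ξ-positive σ}}
    (σ ^- 4) {{ℚ.normalize-pos 1 (σ ℕ.^ 4) {{ℕ.m^n≢0 σ 4}}}}
  1/q≤c = positive⇒1/≤ c {{c-positive}}
  q = suc (proj₁ 1/q≤c)
  K = 2 ℕ.* window σ q
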